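{- Let $p$ and $n$ be positive integers and let $$S_{p,n} = \langle p^{2n+1},\ p^{2n+1}+p^n,\ p^{2n+1}+p^{n+1},\ p^{2n+1}+p^{n+1}+1\rangle .$$ Then $\mathrm E(S_{p,n},2)=p^{2n+1}-p^{2n}+p^n$.
   Context: $\mathbb N$ denotes the non-negative integers, and $\langle n_1,\dots,n_m\rangle:=n_1\mathbb N+\cdots+n_m\mathbb N$, which is a numerical semigroup when the $n_i$ are positive integers with $\gcd(n_1,\dots,n_m)=1$. $S_{p,n}$ is called the generalized Suzuki numerical semigroup. For a numerical semigroup $\Gamma$ and $x\in\mathbb Z$, the Apéry set is $\operatorname{Ap}(\Gamma,x)=\{a\in\Gamma\mid a-x\notin\Gamma\}$. Second Feng-Rao number: for $b\in\Gamma$ let $\mathrm D(b)=\{c\in\Gamma\mid b-c\in\Gamma\}$, and let $\delta^2_{FR}(a)=\min\{\#(\mathrm D(b_1)\cup \mathrm D(b_2))\mid b_1,b_2\in\Gamma,\ a\le b_1<b_2\}$. With $c$ the conductor of $\Gamma$ (least integer $c\ge0$ such that all integers $\ge c$ lie in $\Gamma$) and $g=\#(\mathbb N\setminus\Gamma)$ the genus, $\mathrm E(\Gamma,2)$ is the constant such that $\delta^2_{FR}(a)=a+1-2g+\mathrm E(\Gamma,2)$ for all non-negative integers $a\ge 2c-1$. It is known (and may be taken as the definition) that $\mathrm E(\Gamma,2)=\min\{\#\operatorname{Ap}(\Gamma,x)\mid x\in\mathbb N\setminus\{0\}\}$. -}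

module Defs where

open import Data.Integer as ℤ using (ℤ)
open import Data.List using (List; length)
open import Data.List.Membership.Propositional using () renaming (_∈_ to _∈ˡ_)
open import Data.List.Relation.Unary.Unique.Propositional using (Unique)
open import Data.Nat using (ℕ; _+_; _*_; _∸_; _^_; _≤_; NonZero; >-nonZero)
open import Data.Nat.DivMod using (_/_; _%_; m≡m%n+[m/n]*n; m%n<n; /-monoˡ-≤; m*n/n≡m)
open import Data.Nat.Properties
open import Data.Nat.Solver using (module +-*-Solver)
open import Data.Product using (∃; _×_; _,_)
open import Data.Vec using (Vec; []; _∷_; sum; zipWith; replicate)
open import Function using (_⇔_)
open import Level using (0ℓ)
open import Relation.Binary.PropositionalEquality
open import Relation.Nullary using (¬_)
open import Relation.Unary using (Pred; _∈_)

infix 4 _∈ℤ_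

record NumericalSemigroup : Set₁ where
  field
    carrier  : Pred ℕ 0ℓ
    0∈       : 0 ∈ carrier
    +-closed : ∀ {a b} → a ∈ carrier → b ∈ carrier → a + b ∈ carrier
    cofinite : ∃ λ c → ∀ m → c ≤ m → m ∈ carrier

open NumericalSemigroup public using (carrier)

-- Membership of a possibly negative integer.
_∈ℤ_ : ℤ → NumericalSemigroup → Set
z ∈ℤ Γ = ∃ λ m → m ∈ carrier Γ × z ≡ ℤ.+ m

Ap : NumericalSemigroup → ℤ → Pred ℕ 0ℓ
Ap Γ x a = a ∈ carrier Γ × ¬ (ℤ.+ a ℤ.- x ∈ℤ Γ)

-- P is finite with exactly k elements.  Counting Σ ℕ P instead would be wrong,
-- as P a may have many proofs.
HasSize : Pred ℕ 0ℓ → ℕ → Set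
HasSize P k = ∃ λ (as : List ℕ) → Unique as × (∀ a → a ∈ˡ as ⇔ P a) × length as ≡ k

IsMin : Pred ℕ 0ℓ → ℕ → Set
IsMin P e = P e × (∀ k → P k → e ≤ k)

-- IsE₂ Γ e says that E(Γ,2) = e, where
-- E(Γ,2) = min { #Ap(Γ,x) | x a positive integer }.
IsE₂ : NumericalSemigroup → ℕ → Set
IsE₂ Γ = IsMin (λ k → ∃ λ x → x ≢ 0 × HasSize (Ap Γ (ℤ.+ x)) k)

⟨_⟩ : ∀ {m} → Vec ℕ m → Pred ℕ 0ℓ
⟨_⟩ {m} ns a = ∃ λ (ks : Vec ℕ m) → a ≡ sum (zipWith _*_ ns ks)

⟨⟩-0∈ : ∀ {m} (ns : Vec ℕ m) → 0 ∈ ⟨ ns ⟩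
⟨⟩-0∈ {m} ns = replicate m 0 , go ns
  where
  go : ∀ {m} (ns : Vec ℕ m) → 0 ≡ sum (zipWith _*_ ns (replicate m 0))
  go []       = refl
  go (n ∷ ns) = cong₂ _+_ (sym (*-zeroʳ n)) (go ns)

⟨⟩-+-closed : ∀ {m} (ns : Vec ℕ m) {a b} → a ∈ ⟨ ns ⟩ → b ∈ ⟨ ns ⟩ → a + b ∈ ⟨ ns ⟩
⟨⟩-+-closed ns (ks , refl) (ls , refl) = zipWith _+_ ks ls , go ns ks ls
  where
  open +-*-Solver
  go : ∀ {m} (ns ks ls : Vec ℕ m) →
       sum (zipWith _*_ ns ks) + sum (zipWith _*_ ns ls) ≡ sum (zipWith _*_ ns (zipWith _+_ ks ls))
  go []       []       []       = refl
  go (n ∷ ns) (k ∷ ks) (l ∷ ls) = trans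
    (solve 5 (λ n k l s t → (n :* k :+ s) :+ (n :* l :+ t) := n :* (k :+ l) :+ (s :+ t))
      refl n k l (sum (zipWith _*_ ns ks)) (sum (zipWith _*_ ns ls)))
    (cong (n * (k + l) +_) (go ns ks ls))

-- Every m ≥ a² is a combination of a and a + 1: write m = q a + r with r < a ≤ q,
-- so that m = (q - r) a + r (a + 1).
consecutive : ∀ a .{{_ : NonZero a}} m → a * a ≤ m → ∃ λ k → ∃ λ l → m ≡ a * k + (a + 1) * l
consecutive a m a²≤m = q ∸ r , r , (begin
  m                          ≡⟨ m≡m%n+[m/n]*n m a ⟩
  r + q * a                  ≡⟨ cong (λ z → r + z * a) (m∸n+n≡m r≤q) ⟨
  r + (q ∸ r + r) * a        ≡⟨ solve 3 (λ a r d → r :+ (d :+ r) :* a := a :* d :+ (a :+ con 1) :* r)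
                                  refl a r (q ∸ r) ⟩
  a * (q ∸ r) + (a + 1) * r  ∎)
  where
  open +-*-Solver
  open ≡-Reasoning
  q = m / a
  r = m % a
  r≤q : r ≤ q
  r≤q = ≤-trans (<⇒≤ (m%n<n m a)) (subst (_≤ q) (m*n/n≡m a a) (/-monoˡ-≤ a a²≤m))

suzukiGenerators : ℕ → ℕ → Vec ℕ 4
suzukiGenerators p n =
    p ^ (2 * n + 1)
  ∷ p ^ (2 * n + 1) + p ^ n
  ∷ p ^ (2 * n + 1) + p ^ (n + 1)
  ∷ p ^ (2 * n + 1) + p ^ (n + 1) + 1
  ∷ []

S : (p n : ℕ) .{{_ : NonZero p}} → NumericalSemigroup
S p n = record
  { carrier  = ⟨ suzukiGenerators p n ⟩
  ; 0∈       = ⟨⟩-0∈ (suzukiGenerators p n)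
  ; +-closed = ⟨⟩-+-closed (suzukiGenerators p n)
  ; cofinite = g * g , λ m g²≤m → let k , l , m≡ = consecutive g m g²≤m in
      0 ∷ 0 ∷ k ∷ l ∷ [] , trans m≡ (solve 5
        (λ u v g k l → g :* k :+ (g :+ con 1) :* l :=
           u :* con 0 :+ (v :* con 0 :+ (g :* k :+ ((g :+ con 1) :* l :+ con 0))))
        refl (p ^ (2 * n + 1)) (p ^ (2 * n + 1) + p ^ n) g k l)
  }
  where
  open +-*-Solver
  g = p ^ (2 * n + 1) + p ^ (n + 1)
  instance
    g≢0 : NonZero g
    g≢0 = >-nonZero (≤-trans (m^n>0 p (2 * n + 1)) (m≤m+n _ _))

-- Write Q = pⁿ.  The semigroup is an iterated gluing
--   B = Qℕ + (Q + 1)ℕ,  A = pB + (pQ + 1)ℕ,  S = QA + (p²ⁿ⁺¹ + pⁿ⁺¹ + 1)ℕ,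
-- each step having the form G = kΓ + gℕ with g = kh + 1 ∈ Γ.  In such a step
-- #Ap(G, kξ) = k #Ap(Γ, ξ).  If x has residue δ ≠ 0 modulo k, then each residue d < δ
-- contributes #Ap(Γ, y) ≥ y elements to Ap(G, x), where k y = (k − δ) g + x; together
-- these are at least (k − 1) h + 1.  Hence the minimum for G is at least the smaller of
-- (k − 1) h + 1 and k times the minimum for Γ.  Three steps from ℕ give the bounds Q,
-- (p − 1) Q + 1 and Q ((p − 1) Q + 1); the last is attained at x = Q.
module Submission where

open import Defs
open import Data.Empty using (⊥-elim)
open import Data.Fin as Fin using (Fin; toℕ; fromℕ<; inject≤; combine; remQuot)
open import Data.Fin.Properties using
  ( toℕ<n; toℕ-fromℕ<; toℕ-injective; inject≤-injective; injective⇒≤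
  ; combine-remQuot; remQuot-combine)
open import Data.Integer as ℤ using ()
import Data.Integer.Properties as ℤ
open import Data.List using (length; lookup; tabulate)
open import Data.List.Properties using (length-tabulate)
open import Data.List.Membership.Propositional using () renaming (_∈_ to _∈ˡ_)
open import Data.List.Membership.Propositional.Properties using (∈-tabulate⁺; ∈-tabulate⁻)
open import Data.List.Relation.Unary.Any using (index)
open import Data.List.Relation.Unary.Any.Properties using (lookup-index)
open import Data.List.Relation.Unary.Unique.Propositional.Properties using (tabulate⁺)
open import Data.Nat using
  (ℕ; zero; suc; pred; _+_; _*_; _∸_; _^_; _≤_; _<_; z≤n; s≤s; z<s; NonZero; ≢-nonZero)
open import Data.Nat.DivMod using
  (_/_; _%_; m≡m%n+[m/n]*n; m%n<n; /-monoˡ-≤; m*n/n≡m; [m+kn]%n≡m%n; m<n⇒m%n≡m)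
open import Data.Nat.Properties
open import Data.Nat.Tactic.RingSolver using (solve-∀)
open import Data.Product using (∃; ∃₂; _×_; _,_; proj₁; proj₂)
open import Data.Sum using (inj₁; inj₂)
open import Data.Unit using (⊤; tt)
open import Data.Vec using ([]; _∷_)
open import Function using (_⇔_; mk⇔; Equivalence; Injective)
open import Level using (0ℓ)
open import Relation.Binary.Definitions using (tri<; tri≈; tri>)
open import Relation.Binary.PropositionalEquality
open import Relation.Nullary using (yes; no)
open import Relation.Unary using (Pred; Decidable; _∈_)

-- Division with remainder.

div-mod : ∀ k .{{_ : NonZero k}} z → z ≡ k * (z / k) + z % k
div-mod k z = trans (m≡m%n+[m/n]*n z k)
  (trans (+-comm (z % k) _) (cong (_+ z % k) (*-comm (z / k) k)))

div-mod-unique : ∀ k {a b r s} → r < k → s < k → k * a + r ≡ k * b + s → a ≡ b × r ≡ s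
div-mod-unique k@(suc _) {a} {b} {r} {s} r<k s<k eq = a≡b , r≡s
  where
  remainder : ∀ c {t} → t < k → (k * c + t) % k ≡ t
  remainder c {t} t<k = trans (cong (_% k) (trans (+-comm _ t) (cong (t +_) (*-comm k c))))
    (trans ([m+kn]%n≡m%n t c k) (m<n⇒m%n≡m t<k))
  r≡s : r ≡ s
  r≡s = trans (sym (remainder a r<k)) (trans (cong (_% k) eq) (remainder b s<k))
  a≡b : a ≡ b
  a≡b = *-cancelˡ-≡ a b k (+-cancelʳ-≡ r (k * a) (k * b) (trans eq (cong (k * b +_) (sym r≡s))))

-- Counting the elements of a predicate.

-- Witnesses that `P` has at least `N` elements. Lower bounds are carried in this form, without
-- listing all of `P`.
Embedding : Pred ℕ 0ℓ → ℕ → Set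
Embedding P N = ∃ λ (f : Fin N → ℕ) → Injective _≡_ _≡_ f × (∀ i → P (f i))

Enumeration : Pred ℕ 0ℓ → ℕ → Set
Enumeration P N = ∃ λ ((f , _) : Embedding P N) → ∀ a → P a → ∃ λ i → a ≡ f i

embedding-≤ : ∀ {P M N} → M ≤ N → Embedding P N → Embedding P M
embedding-≤ M≤N (f , inj , f∈P) =
  (λ i → f (inject≤ i M≤N)) ,
  (λ eq → inject≤-injective M≤N M≤N _ _ (inj eq)) ,
  λ i → f∈P (inject≤ i M≤N)

enumeration⇒hasSize : ∀ {P N} → Enumeration P N → HasSize P N
enumeration⇒hasSize {P} ((f , inj , f∈P) , onto) =
  tabulate f , tabulate⁺ inj , (λ a → mk⇔ (to a) (from a)) , length-tabulate f
  where
  to : ∀ a → a ∈ˡ tabulate f → P a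
  to a a∈ with i , refl ← ∈-tabulate⁻ a∈ = f∈P i
  from : ∀ a → P a → a ∈ˡ tabulate f
  from a a∈P with i , refl ← onto a a∈P = ∈-tabulate⁺ i

-- Pigeonhole: equal positions in the list force equal values of `f`, so `Fin N` injects into the
-- positions.
embedding-hasSize-≤ : ∀ {P N k} → Embedding P N → HasSize P k → N ≤ k
embedding-hasSize-≤ (f , inj , f∈P) (as , _ , as⇔P , refl) = injective⇒≤ {f = position} λ {i} {j} eq →
  inj (trans (lookup-index (f∈as i)) (trans (cong (lookup as) eq) (sym (lookup-index (f∈as j)))))
  where
  f∈as : ∀ i → f i ∈ˡ as
  f∈as i = Equivalence.from (as⇔P (f i)) (f∈P i)
  position : Fin _ → Fin (length as)
  position i = index (f∈as i)

-- Apéry sets without integers.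

-- The condition that a - x lies outside `Γ`, phrased by addition so that it stays in ℕ.
Apℕ : Pred ℕ 0ℓ → ℕ → Pred ℕ 0ℓ
Apℕ Γ x a = a ∈ Γ × (∀ {b} → b ∈ Γ → b + x ≢ a)

module _ (Γ Δ : NumericalSemigroup) (Γ⇔Δ : ∀ a → carrier Γ a ⇔ carrier Δ a) where
  private
    difference : ∀ b x → ℤ.+ (b + x) ℤ.- ℤ.+ x ≡ ℤ.+ b
    difference b x = trans (ℤ.+-assoc (ℤ.+ b) (ℤ.+ x) (ℤ.- (ℤ.+ x)))
      (trans (cong (λ z → ℤ.+ b ℤ.+ z) (ℤ.+-inverseʳ (ℤ.+ x))) (ℤ.+-identityʳ (ℤ.+ b)))

  Ap⇒Apℕ : ∀ {x a} → Ap Γ (ℤ.+ x) a → Apℕ (carrier Δ) x a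
  Ap⇒Apℕ {x} {a} (a∈ , a-x∉) = Equivalence.to (Γ⇔Δ a) a∈ , λ {b} b∈ b+x≡a →
    a-x∉ (b , Equivalence.from (Γ⇔Δ b) b∈ , trans (cong (λ z → ℤ.+ z ℤ.- ℤ.+ x) (sym b+x≡a)) (difference b x))

  Apℕ⇒Ap : ∀ {x a} → Apℕ (carrier Δ) x a → Ap Γ (ℤ.+ x) a
  Apℕ⇒Ap {x} {a} (a∈ , a-x∉) = Equivalence.from (Γ⇔Δ a) a∈ , λ (b , b∈ , a-x≡b) →
    a-x∉ (Equivalence.to (Γ⇔Δ b) b∈) (ℤ.+-injective (trans (cong (λ z → z ℤ.+ ℤ.+ x) (sym a-x≡b))
      (trans (ℤ.+-assoc (ℤ.+ a) (ℤ.- (ℤ.+ x)) (ℤ.+ x))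
        (trans (cong (λ z → ℤ.+ a ℤ.+ z) (ℤ.+-inverseˡ (ℤ.+ x))) (ℤ.+-identityʳ (ℤ.+ a))))))

-- Apéry sets by residue classes.

multiple-∈ : ∀ Γ {a} → a ∈ carrier Γ → ∀ n → a * n ∈ carrier Γ
multiple-∈ Γ {a} a∈ zero    = subst (carrier Γ) (sym (*-zeroʳ a)) (NumericalSemigroup.0∈ Γ)
multiple-∈ Γ {a} a∈ (suc n) = subst (carrier Γ) (sym (*-suc a n))
  (NumericalSemigroup.+-closed Γ a∈ (multiple-∈ Γ a∈ n))

module _ (Γ : NumericalSemigroup) (Γ? : Decidable (carrier Γ)) (Y : ℕ) .{{_ : NonZero Y}} where
  private
    -- Subtract `Y` until the next subtraction would leave `Γ`; at `t < Y` it would leave ℕ.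
    descend : ∀ {t} → t < Y → ∀ n → Y * n + t ∈ carrier Γ → ∃ λ n′ → Apℕ (carrier Γ) Y (Y * n′ + t)
    descend {t} t<Y zero    t∈ = zero , t∈ , λ {b} _ b+Y≡t →
      <⇒≱ t<Y (subst (Y ≤_) (trans b+Y≡t (cong (_+ t) (*-zeroʳ Y))) (m≤n+m Y b))
    descend {t} t<Y (suc n) z∈ with Γ? (Y * n + t)
    ... | yes z-Y∈ = descend t<Y n z-Y∈
    ... | no  z-Y∉ = suc n , z∈ , λ {b} b∈ b+Y≡z → z-Y∉ (subst (carrier Γ)
                       (+-cancelʳ-≡ Y b _ (trans b+Y≡z (next Y n t))) b∈)
      where
      next : ∀ Y n t → Y * suc n + t ≡ Y * n + t + Y
      next = solve-∀

    least : (i : Fin Y) → ∃ λ n → Apℕ (carrier Γ) Y (Y * n + toℕ i)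
    least i = let c , large = NumericalSemigroup.cofinite Γ in
      descend (toℕ<n i) c (large _ (≤-trans (m≤n*m c Y) (m≤m+n (Y * c) (toℕ i))))

  -- Every residue class modulo `Y` contains an Apéry element, because `Γ` is cofinite.
  apéry-embedding : Embedding (Apℕ (carrier Γ) Y) Y
  apéry-embedding =
    (λ i → Y * proj₁ (least i) + toℕ i) ,
    (λ {i} {j} eq → toℕ-injective (proj₂ (div-mod-unique Y (toℕ<n i) (toℕ<n j) eq))) ,
    λ i → proj₂ (least i)

  -- Once `Y` lies in `Γ`, adding `Y` never leaves `Γ`, so each class has only one Apéry element.
  apéry-enumeration : Y ∈ carrier Γ → Enumeration (Apℕ (carrier Γ) Y) Y
  apéry-enumeration Y∈ = apéry-embedding , onto
    where
    not-above : ∀ {m n t} → m < n → Y * m + t ∈ carrier Γ → Apℕ (carrier Γ) Y (Y * n + t) → ∀ {A : Set} → A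
    not-above {m} {n} {t} m<n z∈ (_ , z′-Y∉) =
      let o , n≡ = m≤n⇒∃[o]m+o≡n m<n in
      ⊥-elim (z′-Y∉ (NumericalSemigroup.+-closed Γ z∈ (multiple-∈ Γ Y∈ o))
        (trans (shift Y m o t) (cong (λ l → Y * l + t) n≡)))
      where
      shift : ∀ Y m o t → Y * m + t + Y * o + Y ≡ Y * (suc m + o) + t
      shift = solve-∀

    onto : ∀ a → Apℕ (carrier Γ) Y a → ∃ λ i → a ≡ Y * proj₁ (least i) + toℕ i
    onto a a∈Ap = i , trans a≡ (cong (λ l → Y * l + toℕ i) same)
      where
      i : Fin Y
      i = fromℕ< (m%n<n a Y)
      a≡ : a ≡ Y * (a / Y) + toℕ i
      a≡ = trans (div-mod Y a) (cong (Y * (a / Y) +_) (sym (toℕ-fromℕ< (m%n<n a Y))))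
      a∈Ap′ : Apℕ (carrier Γ) Y (Y * (a / Y) + toℕ i)
      a∈Ap′ = subst (Apℕ (carrier Γ) Y) a≡ a∈Ap
      same : a / Y ≡ proj₁ (least i)
      same with <-cmp (a / Y) (proj₁ (least i))
      ... | tri< lt _ _ = not-above lt (proj₁ a∈Ap′) (proj₂ (least i))
      ... | tri≈ _ eq _ = eq
      ... | tri> _ _ gt = not-above gt (proj₁ (proj₂ (least i))) a∈Ap′

-- Gluings and their Apéry sets.

full : NumericalSemigroup
full = record
  { carrier  = λ _ → ⊤
  ; 0∈       = tt
  ; +-closed = λ _ _ → tt
  ; cofinite = 0 , λ _ _ → tt
  }

-- The gluing kΓ + gℕ with g = kh + 1 ∈ Γ.  As g ∈ Γ, the coefficient d of g can be taken
-- below k, and then k y + g d = k (y + h d) + d is division by k.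
module Gluing (k h : ℕ) .{{_ : NonZero k}} (Γ : NumericalSemigroup) (g∈ : k * h + 1 ∈ carrier Γ) where

  Glued : Pred ℕ 0ℓ
  Glued z = ∃₂ λ y d → d < k × y ∈ carrier Γ × z ≡ k * (y + h * d) + d

  -- Writing d = k e + r, the multiple k e of g equals k times g e, and g e lies in `Γ`; only r
  -- copies of g remain.
  combination-∈ : ∀ {y} → y ∈ carrier Γ → ∀ d → k * y + (k * h + 1) * d ∈ Glued
  combination-∈ {y} y∈ d =
    y + (k * h + 1) * (d / k) , d % k , m%n<n d k ,
    NumericalSemigroup.+-closed Γ y∈ (multiple-∈ Γ g∈ (d / k)) ,
    trans (cong (λ e → k * y + (k * h + 1) * e) (div-mod k d)) (regroup k h y (d / k) (d % k))
    where
    regroup : ∀ k h y e r →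
      k * y + (k * h + 1) * (k * e + r) ≡ k * (y + (k * h + 1) * e + h * r) + r
    regroup = solve-∀

  glue : NumericalSemigroup
  glue = record
    { carrier  = Glued
    ; 0∈       = subst Glued (cong₂ _+_ (*-zeroʳ k) (*-zeroʳ (k * h + 1)))
                   (combination-∈ (NumericalSemigroup.0∈ Γ) 0)
    ; +-closed = λ { (y , d , _ , y∈ , refl) (y′ , d′ , _ , y′∈ , refl) →
        subst Glued (regroup k h y d y′ d′)
          (combination-∈ (NumericalSemigroup.+-closed Γ y∈ y′∈) (d + d′)) }
    ; cofinite = let c , large = NumericalSemigroup.cofinite Γ in
        -- From here on the quotient z / k is at least c + h k, so removing h (z % k) leaves at
        -- least c.
        (c + h * k) * k , λ z bound →
          let h*r≤h*k = *-monoʳ-≤ h (<⇒≤ (m%n<n z k))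
              c+h*k≤z/k = subst (_≤ z / k) (m*n/n≡m (c + h * k) k) (/-monoˡ-≤ k bound)
              c+h*r≤z/k = ≤-trans (+-monoʳ-≤ c h*r≤h*k) c+h*k≤z/k
          in z / k ∸ h * (z % k) , z % k , m%n<n z k ,
             large _ (subst (_≤ z / k ∸ h * (z % k)) (m+n∸n≡m c (h * (z % k))) (∸-monoˡ-≤ (h * (z % k)) c+h*r≤z/k)) ,
             trans (div-mod k z) (cong (λ e → k * e + z % k)
               (sym (m∸n+n≡m (≤-trans (m≤n+m (h * (z % k)) c) c+h*r≤z/k))))
    }
    where
    regroup : ∀ k h y d y′ d′ →
      k * (y + y′) + (k * h + 1) * (d + d′) ≡ k * (y + h * d) + d + (k * (y′ + h * d′) + d′)
    regroup = solve-∀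

  -- The representation is unique, with d = z % k and y = z / k - h d, so one membership test in `Γ`
  -- decides. The comparison guards the truncated subtraction.
  glued? : Decidable (carrier Γ) → Decidable Glued
  glued? Γ? z with h * (z % k) ≤? z / k
  ... | no  hr≰ = no λ { (y , d , d<k , y∈ , z≡) →
          let e≡ , r≡ = div-mod-unique k (m%n<n z k) d<k (trans (sym (div-mod k z)) z≡)
          in hr≰ (subst₂ _≤_ (cong (h *_) (sym r≡)) (sym e≡) (m≤n+m (h * d) y)) }
  ... | yes hr≤ with Γ? (z / k ∸ h * (z % k))
  ...   | yes y∈ = yes (_ , z % k , m%n<n z k , y∈ ,
                     trans (div-mod k z) (cong (λ e → k * e + z % k) (sym (m∸n+n≡m hr≤))))
  ...   | no  y∉ = no λ { (y , d , d<k , y∈ , z≡) →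
          let e≡ , r≡ = div-mod-unique k (m%n<n z k) d<k (trans (sym (div-mod k z)) z≡)
          in y∉ (subst (carrier Γ)
               (sym (trans (cong₂ (λ e r → e ∸ h * r) e≡ r≡) (m+n∸n≡m y (h * d)))) y∈) }

  -- Division by `k` recovers d, and then f j. The bound `N ≤ k` covers both all residues and the
  -- residues below some δ.
  product-injective : ∀ {M N} {f : Fin M → ℕ} → Injective _≡_ _≡_ f → N ≤ k →
    Injective _≡_ _≡_ (λ i → let j , d = remQuot {M} N i in k * (f j + h * toℕ d) + toℕ d)
  product-injective {M} {N} {f} inj N≤k {i} {i′} eq =
    trans (sym (combine-remQuot {M} N i))
      (trans (cong₂ combine (inj f≡) (toℕ-injective d≡)) (combine-remQuot {M} N i′))
    where
    d≡,e≡ = div-mod-unique k (<-≤-trans (toℕ<n (proj₂ (remQuot {M} N i))) N≤k)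
                             (<-≤-trans (toℕ<n (proj₂ (remQuot {M} N i′))) N≤k) eq
    d≡ = proj₂ d≡,e≡
    f≡ = +-cancelʳ-≡ _ _ _ (trans (proj₁ d≡,e≡)
           (cong (λ d → f (proj₁ (remQuot {M} N i′)) + h * d) (sym d≡)))

  -- Adding k ξ keeps the residue d and replaces y by y + ξ, so each of the k residues carries a
  -- copy of Ap(Γ, ξ).
  apéry-multiple-embedding : ∀ {ξ N} →
    Embedding (Apℕ (carrier Γ) ξ) N → Embedding (Apℕ Glued (k * ξ)) (N * k)
  apéry-multiple-embedding {ξ} {N} (f , inj , f∈) = _ , product-injective inj ≤-refl , λ _ → member _ _
    where
    member : ∀ (j : Fin N) (d : Fin k) → Apℕ Glued (k * ξ) (k * (f j + h * toℕ d) + toℕ d)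
    member j d = (f j , toℕ d , toℕ<n d , proj₁ (f∈ j) , refl) , λ { (y , d′ , d′<k , y∈ , refl) eq →
      let e≡ , d≡ = div-mod-unique k d′<k (toℕ<n d) (trans (regroup k h y d′ ξ) eq)
      in proj₂ (f∈ j) y∈ (+-cancelʳ-≡ (h * toℕ d) _ _
           (trans (cong (λ d → y + ξ + h * d) (sym d≡)) e≡)) }
      where
      regroup : ∀ k h y d ξ → k * (y + ξ + h * d) + d ≡ k * (y + h * d) + d + k * ξ
      regroup = solve-∀

  apéry-multiple-enumeration : ∀ {ξ N} →
    Enumeration (Apℕ (carrier Γ) ξ) N → Enumeration (Apℕ Glued (k * ξ)) (N * k)
  apéry-multiple-enumeration {ξ} {N} (e@(f , _) , onto) = apéry-multiple-embedding e , onto′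
    where
    onto′ : ∀ a → Apℕ Glued (k * ξ) a →
      ∃ λ i → a ≡ (let j , d = remQuot {N} k i in k * (f j + h * toℕ d) + toℕ d)
    onto′ a ((y , d , d<k , y∈ , refl) , a-kξ∉) =
      let i , y≡ = onto y (y∈ , λ {b} b∈ b+ξ≡y → a-kξ∉ (b , d , d<k , b∈ , refl)
                     (trans (regroup k h b d ξ) (cong (λ y → k * (y + h * d) + d) b+ξ≡y)))
      in combine i (fromℕ< d<k) ,
         trans (cong₂ (λ y d → k * (y + h * d) + d) y≡ (sym (toℕ-fromℕ< d<k)))
           (cong (λ (j , d) → k * (f j + h * toℕ d) + toℕ d) (sym (remQuot-combine i (fromℕ< d<k))))
      where
      regroup : ∀ k h b d ξ → k * (b + h * d) + d + k * ξ ≡ k * (b + ξ + h * d) + d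
      regroup = solve-∀

  -- With j = k − δ, subtracting δ + k q from an element of residue d < δ borrows j copies of g,
  -- since g ≡ 1 (mod k).
  apéry-residue-embedding : ∀ {δ j q N} → δ + j ≡ k →
    Embedding (Apℕ (carrier Γ) (j * h + suc q)) N → Embedding (Apℕ Glued (δ + k * q)) (N * δ)
  apéry-residue-embedding {δ} {j} {q} {N} refl (f , inj , f∈) = _ , product-injective inj (m≤m+n δ j) , λ _ → member _ _
    where
    member : ∀ (l : Fin N) (d : Fin δ) → Apℕ Glued (δ + k * q) (k * (f l + h * toℕ d) + toℕ d)
    member l d = (f l , toℕ d , d<k , proj₁ (f∈ l) , refl) , λ { (y , d′ , d′<k , y∈ , refl) eq → shifted y d′ d′<k y∈ eq }
      where
      d<k : toℕ d < k
      d<k = <-≤-trans (toℕ<n d) (m≤m+n δ j)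
      no-carry : ∀ k h y d δ q → k * (y + h * d + q) + (δ + d) ≡ k * (y + h * d) + d + (δ + k * q)
      no-carry = solve-∀
      carry : ∀ δ j h y e q →
        (δ + j) * (y + h * (j + e) + suc q) + e ≡ (δ + j) * (y + h * (j + e)) + (j + e) + (δ + (δ + j) * q)
      carry = solve-∀
      cancel : ∀ h y j e q → y + h * (j + e) + suc q ≡ y + (j * h + suc q) + h * e
      cancel = solve-∀
      shifted : ∀ y d′ → d′ < k → y ∈ carrier Γ →
        k * (y + h * d′) + d′ + (δ + k * q) ≢ k * (f l + h * toℕ d) + toℕ d
      shifted y d′ d′<k y∈ eq with j ≤? d′
      -- For d′ < j there is no carry: the sum has residue δ + d′, which is at least δ and so cannot
      -- be d.
      ... | no j≰d′ = <⇒≱ (toℕ<n d) (subst (δ ≤_)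
            (proj₂ (div-mod-unique k (+-monoʳ-< δ (≰⇒> j≰d′)) d<k (trans (no-carry k h y d′ δ q) eq)))
            (m≤m+n δ d′))
      -- For d′ = j + e the sum δ + d′ carries once; the residue becomes e, and y gains j h + q + 1.
      ... | yes j≤d′ with e , refl ← m≤n⇒∃[o]m+o≡n j≤d′ =
        let y≡ , e≡ = div-mod-unique k (≤-<-trans (m≤n+m e j) d′<k) d<k (trans (carry δ j h y e q) eq)
        in proj₂ (f∈ l) y∈ (+-cancelʳ-≡ (h * e) _ _
             (trans (sym (cancel h y j e q)) (trans y≡ (cong (λ d → f l + h * d) (sym e≡)))))

  glued-lower-bound : Decidable (carrier Γ) → ∀ {M N} →
    (∀ ξ → ξ ≢ 0 → Embedding (Apℕ (carrier Γ) ξ) N) →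
    M ≤ N * k → M ≤ pred k * h + 1 →
    ∀ x → x ≢ 0 → Embedding (Apℕ Glued x) M
  glued-lower-bound Γ? {M} lower M≤Nk M≤ x x≢0 with x % k in x%k≡
  ... | zero  = embedding-≤ {Apℕ Glued x} M≤Nk (subst (λ x → Embedding (Apℕ Glued x) _) (sym x≡)
          (apéry-multiple-embedding (lower (x / k) λ ξ≡0 → x≢0 (trans x≡ (trans (cong (k *_) ξ≡0) (*-zeroʳ k))))))
    where
    x≡ : x ≡ k * (x / k)
    x≡ = trans (div-mod k x) (trans (cong (k * (x / k) +_) x%k≡) (+-identityʳ _))
  -- The residue is `suc δ` and its complement in k is `suc j`; both are positive.
  ... | suc δ with j , δ+j≡k ← m≤n⇒∃[o]m+o≡n (subst (_< k) x%k≡ (m%n<n x k)) =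
          embedding-≤ {Apℕ Glued x} (≤-trans M≤ bound)
            (subst (λ x → Embedding (Apℕ Glued x) (y * suc δ)) (sym x≡)
              (apéry-residue-embedding 1+δ+1+j≡k
                (apéry-embedding Γ Γ? y {{≢-nonZero (m+1+n≢0 (suc j * h))}})))
    where
    y = suc j * h + suc (x / k)
    1+δ+1+j≡k : suc δ + suc j ≡ k
    1+δ+1+j≡k = trans (+-suc (suc δ) j) δ+j≡k
    x≡ : x ≡ suc δ + k * (x / k)
    x≡ = trans (div-mod k x) (trans (cong (k * (x / k) +_) x%k≡) (+-comm _ (suc δ)))
    -- The coefficient of h is (j + 1)(δ + 1) = (k - 1) + j δ, since k - 1 = δ + j + 1.
    expand : ∀ j h q δ →
      (suc j * h + suc q) * suc δ ≡ (δ + suc j) * h + 1 + (j * δ * h + δ + q * suc δ)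
    expand = solve-∀
    bound : pred k * h + 1 ≤ y * suc δ
    bound = subst₂ (λ k n → pred k * h + 1 ≤ n) 1+δ+1+j≡k (sym (expand j h (x / k) δ)) (m≤m+n _ _)

module _ (k h : ℕ) (Γ : NumericalSemigroup) (g∈ : suc k * h + 1 ∈ carrier Γ) where
  open Gluing (suc k) h Γ g∈

  -- The case δ = 1, now with an exact count. With h in `Γ`, an element of positive residue stays in
  -- the gluing after subtracting 1: one g is traded for one more h in the `Γ` part. So only residue
  -- 0 contributes.
  apéry-one-enumeration : h ∈ carrier Γ → ∀ {N} →
    Enumeration (Apℕ (carrier Γ) (k * h + 1)) N → Enumeration (Apℕ Glued 1) N
  apéry-one-enumeration h∈ {N} ((f , inj , f∈) , onto) =
    ((λ i → suc k * f i) , (λ eq → inj (*-cancelˡ-≡ _ _ (suc k) eq)) , λ i → member (f i) (f∈ i)) , onto′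
    where
    no-carry : ∀ k h y d → suc k * (y + h * d) + suc d ≡ suc k * (y + h * d) + d + 1
    no-carry = solve-∀
    carry : ∀ k h y → suc k * (y + (k * h + 1)) ≡ suc k * (y + h * k) + k + 1
    carry = solve-∀
    lower : ∀ k h y d → suc k * (y + h + h * d) + d + 1 ≡ suc k * (y + h * suc d) + suc d
    lower = solve-∀
    zero-residue : ∀ k h y → suc k * y ≡ suc k * (y + h * 0) + 0
    zero-residue = solve-∀

    member : ∀ y → Apℕ (carrier Γ) (k * h + 1) y → Apℕ Glued 1 (suc k * y)
    member y (y∈ , y-Y∉) = (y , 0 , z<s , y∈ , zero-residue k h y) ,
      λ { (y′ , d , d<1+k , y′∈ , refl) eq → excluded y′ d d<1+k y′∈ eq }
      where
      excluded : ∀ y′ d → d < suc k → y′ ∈ carrier Γ → suc k * (y′ + h * d) + d + 1 ≢ suc k * y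
      excluded y′ d (s≤s d≤k) y′∈ eq with m≤n⇒m<n∨m≡n d≤k
      ... | inj₁ d<k = 1+n≢0 (proj₂ (div-mod-unique (suc k) (s≤s d<k) z<s
              (trans (no-carry k h y′ d) (trans eq (sym (+-identityʳ _))))))
      ... | inj₂ refl = y-Y∉ y′∈ (*-cancelˡ-≡ _ _ (suc k) (trans (carry k h y′) eq))

    onto′ : ∀ a → Apℕ Glued 1 a → ∃ λ i → a ≡ suc k * f i
    onto′ a ((y , suc d , d<k , y∈ , refl) , a-1∉) = ⊥-elim (a-1∉
      (y + h , d , <-trans (n<1+n d) d<k , NumericalSemigroup.+-closed Γ y∈ h∈ , refl) (lower k h y d))
    -- A predecessor must use k copies of g, and (k + 1) b + k g + 1 = (k + 1)(b + k h + 1).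
    onto′ a ((y , zero , _ , y∈ , refl) , a-1∉) =
      let i , y≡ = onto y (y∈ , λ {b} b∈ b+Y≡y → a-1∉ (b , k , n<1+n k , b∈ , refl)
                     (trans (sym (carry k h b)) (trans (cong (suc k *_) b+Y≡y) (zero-residue k h y))))
      in i , trans (sym (zero-residue k h y)) (cong (suc k *_) y≡)

-- The Suzuki semigroup as a threefold gluing.

-- Two facts about Q = pⁿ enter: Q ≥ p, encoded as Q = p + e so that the ring solver sees it, and Q
-- = 1 when p = 1.
module Suzuki (p-1 e : ℕ) (p≡1⇒e≡0 : p-1 ≡ 0 → e ≡ 0) where

  p Q Y : ℕ
  p = suc p-1
  Q = suc (p-1 + e)
  Y = p-1 * Q + 1

  module B = Gluing Q 1 full tt

  pQ+1∈B : p * Q + 1 ∈ B.Glued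
  pQ+1∈B = subst B.Glued (identity p-1 Q) (B.combination-∈ {p-1} tt 1)
    where
    identity : ∀ p-1 Q → Q * p-1 + (Q * 1 + 1) * 1 ≡ suc p-1 * Q + 1
    identity = solve-∀

  module A = Gluing p Q B.glue pQ+1∈B

  Q∈B : Q ∈ B.Glued
  Q∈B = 1 , 0 , z<s , tt , identity Q
    where
    identity : ∀ Q → Q ≡ Q * 1 + 0
    identity = solve-∀

  pQQ+pQ+1∈A : Q * (p * Q + p) + 1 ∈ A.Glued
  pQQ+pQ+1∈A = subst A.Glued (identity p Q) (A.combination-∈ (multiple-∈ B.glue Q∈B Q) 1)
    where
    identity : ∀ p Q → p * (Q * Q) + (p * Q + 1) * 1 ≡ Q * (p * Q + p) + 1
    identity = solve-∀

  module C = Gluing Q (p * Q + p) A.glue pQQ+pQ+1∈A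

  -- The coefficients m, l, n multiply the generators added in the three gluings. Forwards they need
  -- reduction, which `combination-∈` does; backwards they are read off the normal forms.
  generated⇔glued : ∀ a →
    ⟨ p * Q * Q ∷ p * Q * Q + Q ∷ p * Q * Q + p * Q ∷ p * Q * Q + p * Q + 1 ∷ [] ⟩ a ⇔ C.Glued a
  generated⇔glued a = mk⇔
    (λ { (k ∷ l ∷ m ∷ n ∷ [] , refl) → subst C.Glued (to p Q k l m n)
           (C.combination-∈ (A.combination-∈ (B.combination-∈ {k} tt m) l) n) })
    (λ { (_ , n , _ , (_ , l , _ , (k , m , _ , _ , refl) , refl) , refl) →
           (k ∷ l ∷ m ∷ n ∷ []) , from p Q k l m n })
    where
    to : ∀ p Q k l m n →
      Q * (p * (Q * k + (Q * 1 + 1) * m) + (p * Q + 1) * l) + (Q * (p * Q + p) + 1) * n ≡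
      p * Q * Q * k + ((p * Q * Q + Q) * l + ((p * Q * Q + p * Q) * m + ((p * Q * Q + p * Q + 1) * n + 0)))
    to = solve-∀
    from : ∀ p Q k l m n →
      Q * (p * (Q * (k + 1 * m) + m + Q * l) + l + (p * Q + p) * n) + n ≡
      p * Q * Q * k + ((p * Q * Q + Q) * l + ((p * Q * Q + p * Q) * m + ((p * Q * Q + p * Q + 1) * n + 0)))
    from = solve-∀

  lower-bound : ∀ x → x ≢ 0 → Embedding (Apℕ C.Glued x) (Y * Q)
  lower-bound = C.glued-lower-bound A? lower-A ≤-refl
    (subst (Y * Q ≤_) (sym (slack p-1 e)) (m≤m+n (Y * Q) _))
    where
    B? : Decidable B.Glued
    B? = B.glued? λ _ → yes tt
    A? : Decidable A.Glued
    A? = A.glued? B?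

    -- The residue bound (Q - 1) p (Q + 1) + 1 exceeds Y Q by (Q - 1)² + e, where e = Q - p.
    slack : ∀ p-1 e → let p = suc p-1 ; Q = suc (p-1 + e) in
      (p-1 + e) * (p * Q + p) + 1 ≡ (p-1 * Q + 1) * Q + ((p-1 + e) * (p-1 + e) + e)
    slack = solve-∀

    lower-full : ∀ ξ → ξ ≢ 0 → Embedding (Apℕ (carrier full) ξ) 1
    lower-full ξ ξ≢0 = (λ _ → 0) , (λ { {Fin.zero} {Fin.zero} _ → refl }) ,
      λ _ → tt , λ {b} _ b+ξ≡0 → ξ≢0 (m+n≡0⇒n≡0 b b+ξ≡0)

    lower-B : ∀ ξ → ξ ≢ 0 → Embedding (Apℕ B.Glued ξ) Q
    lower-B = B.glued-lower-bound (λ _ → yes tt) lower-full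
      (≤-reflexive (sym (*-identityˡ Q)))
      (≤-reflexive (trans (+-comm 1 (p-1 + e)) (cong (_+ 1) (sym (*-identityʳ (p-1 + e))))))

    lower-A : ∀ ξ → ξ ≢ 0 → Embedding (Apℕ A.Glued ξ) Y
    lower-A = A.glued-lower-bound B? lower-B
      (subst (Y ≤_) (sym (*-comm Q p)) (subst (_≤ Q + p-1 * Q) (+-comm 1 (p-1 * Q)) (+-monoˡ-≤ (p-1 * Q) (s≤s z≤n))))
      ≤-refl

  -- For p ≥ 2, Y = (p - 2) Q + (Q + 1). For p = 1, Y = 1 = Q.
  Y∈B : Y ∈ B.Glued
  Y∈B = cases p-1 refl
    where
    identity : ∀ r Q → Q * r + (Q * 1 + 1) * 1 ≡ suc r * Q + 1
    identity = solve-∀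
    cases : ∀ r → r ≡ p-1 → Y ∈ B.Glued
    cases (suc r) refl = subst B.Glued (identity r Q) (B.combination-∈ {r} tt 1)
    cases zero    refl = 1 , 0 , z<s , tt , sym (trans (+-identityʳ _) (trans (*-identityʳ Q) (cong suc (p≡1⇒e≡0 refl))))

  -- #Ap(S, Q) = Q #Ap(A, 1) = Q #Ap(B, Y) = Q Y, the last step because Y lies in B.
  attained : Enumeration (Apℕ C.Glued (Q * 1)) (Y * Q)
  attained = C.apéry-multiple-enumeration (apéry-one-enumeration p-1 Q B.glue pQ+1∈B Q∈B
    (apéry-enumeration B.glue (B.glued? λ _ → yes tt) Y {{≢-nonZero (m+1+n≢0 (p-1 * Q))}} Y∈B))

-- Returning to powers of p.

theorem24 : (p n : ℕ) .{{_ : NonZero p}} .{{_ : NonZero n}} →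
    IsE₂ (S p n) (p ^ (2 * n + 1) ∸ p ^ (2 * n) + p ^ n)
theorem24 p@(suc p-1) n@(suc n-1) =
  (Q * 1 , (λ ()) , subst (HasSize (Ap (S p n) (ℤ.+ (Q * 1)))) YQ≡ (enumeration⇒hasSize apéry)) ,
  λ { k (x , x≢0 , size) → subst (_≤ k) YQ≡ (embedding-hasSize-≤ (apéry-≥ x x≢0) size) }
  where
  p≤pⁿ : p ≤ p ^ n
  p≤pⁿ = subst (_≤ p ^ n) (^-identityʳ p) (^-monoʳ-≤ p {1} {n} (s≤s z≤n))

  -- The difference pⁿ - p, a natural number because n ≥ 1.
  e = proj₁ (m≤n⇒∃[o]m+o≡n p≤pⁿ)

  Q≡pⁿ : suc (p-1 + e) ≡ p ^ n
  Q≡pⁿ = proj₂ (m≤n⇒∃[o]m+o≡n p≤pⁿ)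

  p≡1⇒e≡0 : p-1 ≡ 0 → e ≡ 0
  p≡1⇒e≡0 p-1≡0 = suc-injective (trans (cong (λ r → suc (r + e)) (sym p-1≡0))
    (trans Q≡pⁿ (trans (cong (λ r → suc r ^ n) p-1≡0) (^-zeroˡ n))))

  open Suzuki p-1 e p≡1⇒e≡0 hiding (p)

  p²ⁿ≡ : p ^ (2 * n) ≡ Q * Q
  p²ⁿ≡ = trans (cong (p ^_) (cong (n +_) (+-identityʳ n)))
    (trans (^-distribˡ-+-* p n n) (sym (cong₂ _*_ Q≡pⁿ Q≡pⁿ)))

  p²ⁿ⁺¹≡ : p ^ (2 * n + 1) ≡ p * Q * Q
  p²ⁿ⁺¹≡ = trans (cong (p ^_) (+-comm (2 * n) 1)) (trans (cong (p *_) p²ⁿ≡) (sym (*-assoc p Q Q)))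

  pⁿ⁺¹≡ : p ^ (n + 1) ≡ p * Q
  pⁿ⁺¹≡ = trans (cong (p ^_) (+-comm n 1)) (cong (p *_) (sym Q≡pⁿ))

  YQ≡ : Y * Q ≡ p ^ (2 * n + 1) ∸ p ^ (2 * n) + p ^ n
  YQ≡ = begin
    (p-1 * Q + 1) * Q                      ≡⟨ expand p-1 Q ⟩
    p-1 * Q * Q + Q                        ≡⟨ cong (_+ Q) (m+n∸n≡m (p-1 * Q * Q) (Q * Q)) ⟨
    -- Splitting off Q² makes the truncated subtraction exact.
    p-1 * Q * Q + Q * Q ∸ Q * Q + Q        ≡⟨ cong (λ z → z ∸ Q * Q + Q) (split p-1 Q) ⟨
    p * Q * Q ∸ Q * Q + Q                  ≡⟨ cong₂ _+_ (cong₂ _∸_ (sym p²ⁿ⁺¹≡) (sym p²ⁿ≡)) Q≡pⁿ ⟩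
    p ^ (2 * n + 1) ∸ p ^ (2 * n) + p ^ n  ∎
    where
    open ≡-Reasoning
    expand : ∀ p-1 Q → (p-1 * Q + 1) * Q ≡ p-1 * Q * Q + Q
    expand = solve-∀
    split : ∀ p-1 Q → suc p-1 * Q * Q ≡ p-1 * Q * Q + Q * Q
    split = solve-∀

  S⇔glued : ∀ a → carrier (S p n) a ⇔ C.Glued a
  S⇔glued a = subst (λ gs → ⟨ gs ⟩ a ⇔ C.Glued a) (sym generators≡) (generated⇔glued a)
    where
    generators≡ : suzukiGenerators p n ≡
      p * Q * Q ∷ p * Q * Q + Q ∷ p * Q * Q + p * Q ∷ p * Q * Q + p * Q + 1 ∷ []
    generators≡ = trans
      (cong₂ (λ q pQ → q ∷ q + p ^ n ∷ q + pQ ∷ q + pQ + 1 ∷ []) p²ⁿ⁺¹≡ pⁿ⁺¹≡)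
      (cong (λ b → p * Q * Q ∷ p * Q * Q + b ∷ p * Q * Q + p * Q ∷ p * Q * Q + p * Q + 1 ∷ []) (sym Q≡pⁿ))

  apéry-≥ : ∀ x → x ≢ 0 → Embedding (Ap (S p n) (ℤ.+ x)) (Y * Q)
  apéry-≥ x x≢0 = let f , inj , f∈ = lower-bound x x≢0 in
    f , inj , λ i → Apℕ⇒Ap (S p n) C.glue S⇔glued (f∈ i)

  apéry : Enumeration (Ap (S p n) (ℤ.+ (Q * 1))) (Y * Q)
  apéry = let (f , inj , f∈) , onto = attained in
    (f , inj , λ i → Apℕ⇒Ap (S p n) C.glue S⇔glued (f∈ i)) ,
    λ a a∈ → onto a (Ap⇒Apℕ (S p n) C.glue S⇔glued a∈)
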